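{- The number of order types of $3\times3$ magic squares, i.e. the number of linear orderings of the nine cells that are induced by $3\times 3$ magic squares (with arbitrarily large entries), is $16$. Up to the $8$ symmetries of a magic square there are exactly two order types.
   Context: A $3\times3$ magic square (in the strong sense) is a $3\times 3$ matrix of pairwise distinct positive integers in which all three row sums, all three column sums and both diagonal sums are equal. Its order type is the linear ordering of the nine cells in order of increasing value of their entries. The symmetries are the $8$ symmetries (rotations and reflections) of the square. -}

module Defs where

open import Level using (0ℓ) renaming (suc to lsuc)
open import Data.Fin.Base using (Fin; zero; toℕ; opposite)
open import Data.Fin.Properties using (all?; any?)
import Data.Fin.Properties as Fin
open import Data.Nat.Base using (ℕ; _<_)
open import Data.Nat.Properties using (+-0-monoid; <-irrefl; <-trans; <-cmp)
open import Data.Product.Base using (Σ; ∃; _×_; _,_; proj₁)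
open import Data.Product.Properties using (≡-dec)
open import Function.Base using (_∘_)
open import Function.Bundles using (Inverse; _⇔_)
open import Function.Definitions using (Injective)
import Function.Construct.Composition as Composition
import Function.Construct.Identity as Identity
import Function.Construct.Symmetry as Sym
open import Relation.Binary.Bundles using (Setoid)
open import Relation.Binary.Core using (Rel)
open import Relation.Binary.Definitions using (Trichotomous; tri<; tri≈; tri>)
open import Relation.Binary.Structures using (IsStrictTotalOrder)
open import Relation.Binary.PropositionalEquality
  using (_≡_; refl; sym; cong; subst₂; isEquivalence; resp₂; setoid)
import Relation.Binary.Construct.On as On
open import Relation.Nullary.Decidable using (toWitness; Dec)
open import Algebra.Properties.Monoid.Sum +-0-monoid using (sum)
open import Function.Endo.Propositional using (_^_)

-- (row , column)
Cell : Set
Cell = Fin 3 × Fin 3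

Matrix : Set
Matrix = Cell → ℕ

record IsMagicSquare (M : Matrix) : Set where
  field
    positive     : ∀ c → 0 < M c
    distinct     : Injective _≡_ _≡_ M
    magicSum     : ℕ
    rows         : ∀ i → sum (λ j → M (i , j)) ≡ magicSum
    columns      : ∀ j → sum (λ i → M (i , j)) ≡ magicSum
    diagonal     : sum (λ i → M (i , i)) ≡ magicSum
    antidiagonal : sum (λ i → M (i , opposite i)) ≡ magicSum

MagicSquare : Set
MagicSquare = Σ Matrix IsMagicSquare

record LinearOrdering : Set₁ where
  field
    _≺_                : Rel Cell 0ℓ
    isStrictTotalOrder : IsStrictTotalOrder _≡_ _≺_

-- Orderings are compared extensionally, since equivalent relations need not
-- be propositionally equal.
linearOrderings : Setoid (lsuc 0ℓ) 0ℓ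
linearOrderings = record
  { Carrier       = LinearOrdering
  ; _≈_           = λ L₁ L₂ → ∀ a b → LinearOrdering._≺_ L₁ a b ⇔ LinearOrdering._≺_ L₂ a b
  ; isEquivalence = record
    { refl  = λ a b → Identity.⇔-id _
    ; sym   = λ p a b → Sym.⇔-sym (p a b)
    ; trans = λ p q a b → q a b Composition.⇔-∘ p a b
    }
  }

orderType : MagicSquare → LinearOrdering
orderType (M , isMagic) = record
  { _≺_                = λ a b → M a < M b
  ; isStrictTotalOrder = record
    { isStrictPartialOrder = record
      { isEquivalence = isEquivalence
      ; irrefl        = λ { refl → <-irrefl refl }
      ; trans         = <-trans
      ; <-resp-≈      = resp₂ _
      }
    ; compare = compare
    }
  }
  where
  compare : Trichotomous _≡_ (λ a b → M a < M b)
  compare a b with <-cmp (M a) (M b)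
  ... | tri< lt ne gt = tri< lt (ne ∘ cong M) gt
  ... | tri≈ lt eq gt = tri≈ lt (IsMagicSquare.distinct isMagic eq) gt
  ... | tri> lt ne gt = tri> lt (ne ∘ cong M) gt

OrderType : Set₁
OrderType = Σ LinearOrdering λ L → ∃ λ S → L ≈ orderType S
  where open Setoid linearOrderings using (_≈_)

orderTypes : Setoid (lsuc 0ℓ) 0ℓ
orderTypes = On.setoid {B = OrderType} linearOrderings proj₁

rotate : Cell → Cell
rotate (i , j) = j , opposite i

reflect : Cell → Cell
reflect (i , j) = i , opposite j

data Symmetry : Set where
  rotation   : Fin 4 → Symmetry
  reflection : Fin 4 → Symmetry

act : Symmetry → Cell → Cell
act (rotation k)   = (Cell ^ rotate) (toℕ k)
act (reflection k) = (Cell ^ rotate) (toℕ k) ∘ reflect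

private
  act-≗? : ∀ g (f : Cell → Cell) → Dec (∀ i j → act g (i , j) ≡ f (i , j))
  act-≗? g f = all? λ i → all? λ j → ≡-dec Fin._≟_ Fin._≟_ (act g (i , j)) (f (i , j))

  rot-rot : ∀ k l → ∃ λ m → ∀ i j → act (rotation m) (i , j) ≡ act (rotation k) (act (rotation l) (i , j))
  rot-rot = toWitness {a? = all? λ k → all? λ l → any? λ m → act-≗? (rotation m) (act (rotation k) ∘ act (rotation l))} _

  rot-ref : ∀ k l → ∃ λ m → ∀ i j → act (reflection m) (i , j) ≡ act (rotation k) (act (reflection l) (i , j))
  rot-ref = toWitness {a? = all? λ k → all? λ l → any? λ m → act-≗? (reflection m) (act (rotation k) ∘ act (reflection l))} _

  ref-rot : ∀ k l → ∃ λ m → ∀ i j → act (reflection m) (i , j) ≡ act (reflection k) (act (rotation l) (i , j))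
  ref-rot = toWitness {a? = all? λ k → all? λ l → any? λ m → act-≗? (reflection m) (act (reflection k) ∘ act (rotation l))} _

  ref-ref : ∀ k l → ∃ λ m → ∀ i j → act (rotation m) (i , j) ≡ act (reflection k) (act (reflection l) (i , j))
  ref-ref = toWitness {a? = all? λ k → all? λ l → any? λ m → act-≗? (rotation m) (act (reflection k) ∘ act (reflection l))} _

  rot-inv : ∀ k → ∃ λ m → ∀ i j → act (rotation k) (act (rotation m) (i , j)) ≡ (i , j)
  rot-inv = toWitness {a? = all? λ k → any? λ m → all? λ i → all? λ j →
    ≡-dec Fin._≟_ Fin._≟_ (act (rotation k) (act (rotation m) (i , j))) (i , j)} _

  ref-inv : ∀ k → ∀ i j → act (reflection k) (act (reflection k) (i , j)) ≡ (i , j)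
  ref-inv = toWitness {a? = all? λ k → all? λ i → all? λ j →
    ≡-dec Fin._≟_ Fin._≟_ (act (reflection k) (act (reflection k) (i , j))) (i , j)} _

act-∘ : ∀ g h → ∃ λ k → ∀ c → act k c ≡ act g (act h c)
act-∘ (rotation k)   (rotation l)   = let m , p = rot-rot k l in rotation m   , λ (i , j) → p i j
act-∘ (rotation k)   (reflection l) = let m , p = rot-ref k l in reflection m , λ (i , j) → p i j
act-∘ (reflection k) (rotation l)   = let m , p = ref-rot k l in reflection m , λ (i , j) → p i j
act-∘ (reflection k) (reflection l) = let m , p = ref-ref k l in rotation m   , λ (i , j) → p i j

act-⁻¹ : ∀ g → ∃ λ k → ∀ c → act g (act k c) ≡ c
act-⁻¹ (rotation k)   = let m , p = rot-inv k in rotation m , λ (i , j) → p i j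
act-⁻¹ (reflection k) = reflection k , λ (i , j) → ref-inv k i j

-- If L₂ is the order type of M then the ordering L₁ related to it by g is the
-- order type of the transformed square M ∘ act g.
_≈ₛ_ : Rel LinearOrdering 0ℓ
L₁ ≈ₛ L₂ = ∃ λ g → ∀ a b →
  LinearOrdering._≺_ L₁ a b ⇔ LinearOrdering._≺_ L₂ (act g a) (act g b)

linearOrderingsUpToSymmetry : Setoid (lsuc 0ℓ) 0ℓ
linearOrderingsUpToSymmetry = record
  { Carrier       = LinearOrdering
  ; _≈_           = _≈ₛ_
  ; isEquivalence = record
    { refl  = rotation zero , λ a b → Identity.⇔-id _
    ; sym   = λ {L₁} {L₂} (g , p) → let k , q = act-⁻¹ g in
        k , λ a b → Sym.⇔-sym (subst₂ (λ x y → LinearOrdering._≺_ L₁ (act k a) (act k b) ⇔ LinearOrdering._≺_ L₂ x y)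
                                 (q a) (q b) (p (act k a) (act k b)))
    ; trans = λ {L₁} {L₂} {L₃} (g , p) (h , q) → let k , r = act-∘ h g in
        k , λ a b → subst₂ (λ x y → LinearOrdering._≺_ L₁ a b ⇔ LinearOrdering._≺_ L₃ x y)
                      (sym (r a)) (sym (r b)) (q (act g a) (act g b) Composition.⇔-∘ p a b)
    }
  }

orderTypesUpToSymmetry : Setoid (lsuc 0ℓ) 0ℓ
orderTypesUpToSymmetry = On.setoid {B = OrderType} linearOrderingsUpToSymmetry proj₁

HasCardinality : Setoid (lsuc 0ℓ) 0ℓ → ℕ → Set₁
HasCardinality S n = Inverse S (setoid (Fin n))

{-# OPTIONS --safe #-}

-- With centre e and corners e ± a, e ± b the square is
--   e + a      e − a − b   e + b
--   e − a + b  e           e + a − b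
--   e − b      e + a + b   e − a
-- and the symmetries act on (a , b) by sign changes and exchange, so that one may
-- assume 0 < b < a. The order of the cells is then determined by whether b < a − b
-- or a − b < b, and both cases occur.
module Submission where

open import Defs
open import Data.Fin.Base using (Fin; toℕ; opposite; combine; remQuot)
open import Data.Fin.Patterns using (0F; 1F; 2F; 3F)
open import Data.Fin.Properties using (all?; any?; opposite-involutive; remQuot-combine)
import Data.Fin.Properties as Fin
open import Data.List.Base using (List; []; _∷_)
open import Data.List.Membership.Propositional using (_∈_)
import Data.List.Membership.DecPropositional as DecMembership
import Data.List.Relation.Unary.All as All
open import Data.List.Relation.Unary.AllPairs as AllPairs using (AllPairs; []; _∷_)
open import Data.List.Relation.Unary.Any using (here; there)
open import Data.List.Relation.Unary.Linked using (Linked; [-]; _∷_)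
open import Data.List.Relation.Unary.Linked.Properties using (Linked⇒AllPairs)
open import Data.Nat.Base using (ℕ; zero; suc; _+_; _<_)
open import Data.Nat.Properties
open import Data.Nat.Tactic.RingSolver using (solve-∀)
open import Algebra.Properties.Monoid.Sum +-0-monoid using (sum)
open import Data.Product.Base using (_×_; _,_; ∃; ∃₂; proj₁; proj₂; uncurry)
open import Data.Product.Properties using (≡-dec)
open import Data.Sum.Base using (_⊎_; inj₁; inj₂; fromInj₁)
open import Data.Vec.Base using (Vec; []; _∷_; lookup)
open import Function.Base using (_∘_; _on_)
open import Function.Bundles using (_⇔_; mk⇔; Equivalence)
import Function.Construct.Composition as Composition
open import Function.Definitions using (Injective)
open import Function.Endo.Propositional using (_^_)
open import Level using (0ℓ) renaming (suc to lsuc)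
open import Relation.Binary.Bundles using (Setoid)
open import Relation.Binary.Core using (Rel)
open import Relation.Binary.Definitions using (DecidableEquality; tri<; tri≈; tri>)
open import Relation.Binary.PropositionalEquality
open import Relation.Nullary using (¬_; contradiction)
open import Relation.Nullary.Decidable using (Dec; toWitness; ¬?; _×-dec_; _⊎-dec_; _→-dec_)

-- Cardinality of a setoid from a system of representatives

module _ (S : Setoid (lsuc 0ℓ) 0ℓ) {n : ℕ} where
  private module S = Setoid S
  open S using (_≈_)

  -- Separation makes the index chosen by `covering` the only possible one, which gives the
  -- congruence of `to` and one of the two inverse laws.
  classification⇒cardinality :
    (representative : Fin n → S.Carrier) →
    (∀ i j → representative i ≈ representative j → i ≡ j) →
    (∀ x → ∃ λ i → x ≈ representative i) →
    HasCardinality S n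
  classification⇒cardinality representative separated covering = record
    { to        = class
    ; from      = representative
    ; to-cong   = λ {x} {y} x≈y → class-unique x (S.trans x≈y (proj₂ (covering y)))
    ; from-cong = λ { refl → S.refl }
    ; inverse   = (λ {i} {x} → class-unique x)
                , (λ { {x} refl → S.sym (proj₂ (covering x)) })
    }
    where
    class : S.Carrier → Fin n
    class x = proj₁ (covering x)

    class-unique : ∀ x {i} → x ≈ representative i → class x ≡ i
    class-unique x {i} x≈i = separated (class x) i (S.trans (S.sym (proj₂ (covering x))) x≈i)

-- Transforming magic squares

sum-opposite : ∀ (f : Fin 3 → ℕ) → sum (f ∘ opposite) ≡ sum f
sum-opposite f = reverse (f 0F) (f 1F) (f 2F)
  where
  reverse : ∀ x y z → z + (y + (x + 0)) ≡ x + (y + (z + 0))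
  reverse = solve-∀

opposite-injective : ∀ {n} {i j : Fin n} → opposite i ≡ opposite j → i ≡ j
opposite-injective {i = i} {j} eq =
  trans (sym (opposite-involutive i)) (trans (cong opposite eq) (opposite-involutive j))

rotate-injective : Injective _≡_ _≡_ rotate
rotate-injective eq = cong₂ _,_ (opposite-injective (cong proj₂ eq)) (cong proj₁ eq)

reflect-injective : Injective _≡_ _≡_ reflect
reflect-injective eq = cong₂ _,_ (cong proj₁ eq) (opposite-injective (cong proj₂ eq))

-- A quarter turn permutes the eight lines, reversing some of them; `sum-opposite` absorbs the
-- reversals.
isMagicSquare-rotate : ∀ {M} → IsMagicSquare M → IsMagicSquare (M ∘ rotate)
isMagicSquare-rotate {M} isMagic = record
  { positive     = positive ∘ rotate
  ; distinct     = rotate-injective ∘ distinct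
  ; magicSum     = magicSum
  ; rows         = columns ∘ opposite
  ; columns      = λ j → trans (sum-opposite (λ i → M (j , i))) (rows j)
  ; diagonal     = antidiagonal
  ; antidiagonal = trans (sum-opposite (λ i → M (i , i))) diagonal
  }
  where open IsMagicSquare isMagic

isMagicSquare-reflect : ∀ {M} → IsMagicSquare M → IsMagicSquare (M ∘ reflect)
isMagicSquare-reflect {M} isMagic = record
  { positive     = positive ∘ reflect
  ; distinct     = reflect-injective ∘ distinct
  ; magicSum     = magicSum
  ; rows         = λ i → trans (sum-opposite (λ j → M (i , j))) (rows i)
  ; columns      = columns ∘ opposite
  ; diagonal     = antidiagonal
  -- The double `opposite` cancels by computation at the three concrete indices.
  ; antidiagonal = diagonal
  }
  where open IsMagicSquare isMagic

isMagicSquare-rotate^ : ∀ {M} n → IsMagicSquare M → IsMagicSquare (M ∘ (Cell ^ rotate) n)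
isMagicSquare-rotate^ zero    isMagic = isMagic
-- The outermost `rotate` of the iterate is next to `M`, so the induction continues with the square
-- `M ∘ rotate`.
isMagicSquare-rotate^ (suc n) isMagic = isMagicSquare-rotate^ n (isMagicSquare-rotate isMagic)

isMagicSquare-act : ∀ {M} g → IsMagicSquare M → IsMagicSquare (M ∘ act g)
isMagicSquare-act (rotation k)   isMagic = isMagicSquare-rotate^ (toℕ k) isMagic
isMagicSquare-act (reflection k) isMagic =
  isMagicSquare-reflect (isMagicSquare-rotate^ (toℕ k) isMagic)

-- Comparisons along a chain of cells

_≟ᶜ_ : DecidableEquality Cell
_≟ᶜ_ = ≡-dec Fin._≟_ Fin._≟_

AllPairs-connex : ∀ {A : Set} {R : Rel A 0ℓ} {xs} → AllPairs R xs →
                  ∀ {x y} → x ∈ xs → y ∈ xs → x ≡ y ⊎ R x y ⊎ R y x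
AllPairs-connex (_  ∷ _)  (here refl) (here refl) = inj₁ refl
AllPairs-connex (rs ∷ _)  (here refl) (there y∈)  = inj₂ (inj₁ (All.lookup rs y∈))
AllPairs-connex (rs ∷ _)  (there x∈)  (here refl) = inj₂ (inj₂ (All.lookup rs x∈))
AllPairs-connex (_  ∷ ps) (there x∈)  (there y∈)  = AllPairs-connex ps x∈ y∈

Increasing : Matrix → List Cell → Set
Increasing M = Linked (_<_ on M)

-- Of two different cells one comes first in the common chain, and then both matrices compare them
-- in that direction; asymmetry excludes the other direction.
increasing⇒sameOrder : ∀ {M N cs} → (∀ c → c ∈ cs) → Increasing M cs → Increasing N cs →
                       ∀ a b → M a < M b ⇔ N a < N b
increasing⇒sameOrder complete incM incN a b
  with AllPairs-connex (AllPairs.zip (Linked⇒AllPairs <-trans incM , Linked⇒AllPairs <-trans incN))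
                       (complete a) (complete b)
... | inj₁ refl                   = mk⇔ (λ a<a → contradiction a<a (<-irrefl refl))
                                        (λ a<a → contradiction a<a (<-irrefl refl))
... | inj₂ (inj₁ (Ma<Mb , Na<Nb)) = mk⇔ (λ _ → Na<Nb) (λ _ → Ma<Mb)
... | inj₂ (inj₂ (Mb<Ma , Nb<Na)) = mk⇔ (λ Ma<Mb → contradiction Ma<Mb (<-asym Mb<Ma))
                                        (λ Na<Nb → contradiction Na<Nb (<-asym Nb<Na))

-- Linear relations between the entries

-- Turns the additive identities below into comparisons without subtraction.
<-exchange : ∀ {w x y z} → w + x ≡ y + z → x < z → y < w
<-exchange {w} {x} {y} {z} eq x<z =
  +-cancelʳ-< x y w (subst (y + x <_) (sym eq) (+-monoʳ-< y x<z))

centre : Cell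
centre = 1F , 1F

antipode : Cell → Cell
antipode (i , j) = opposite i , opposite j

module _ {M : Matrix} (isMagic : IsMagicSquare M) where
  open IsMagicSquare isMagic

  private
    e : ℕ
    e = M centre

  -- The four lines through the centre cover every cell once and the centre three
  -- more times, and the three rows cover every cell once.
  magicSum≡3e : magicSum ≡ e + (e + e)
  magicSum≡3e = +-cancelʳ-≡ (magicSum + (magicSum + magicSum)) _ _
    (begin
      magicSum + (magicSum + (magicSum + magicSum))
        ≡⟨ cong₂ _+_ (sym diagonal) (cong₂ _+_ (sym antidiagonal) (cong₂ _+_ (sym (columns 1F)) (sym (rows 1F)))) ⟩
      _ ≡⟨ recount (M (0F , 0F)) (M (0F , 1F)) (M (0F , 2F)) (M (1F , 0F)) e
                   (M (1F , 2F)) (M (2F , 0F)) (M (2F , 1F)) (M (2F , 2F)) ⟩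
      e + (e + e) + _
        ≡⟨ cong (e + (e + e) +_) (cong₂ _+_ (rows 0F) (cong₂ _+_ (rows 1F) (rows 2F))) ⟩
      e + (e + e) + (magicSum + (magicSum + magicSum)) ∎)
    where
    open ≡-Reasoning
    recount : ∀ a b c d e f g h i →
      (a + (e + (i + 0))) + ((c + (e + (g + 0))) + ((b + (e + (h + 0))) + (d + (e + (f + 0))))) ≡
      e + (e + e) + ((a + (b + (c + 0))) + ((d + (e + (f + 0))) + (g + (h + (i + 0)))))
    recount = solve-∀

  -- Removing the centre, a third of the magic sum, from a line through it leaves `e + e`.
  antipodal-sum : ∀ c → M c + M (antipode c) ≡ e + e
  antipodal-sum = λ
    { (0F , 0F) → first (0F , 0F) diagonal
    ; (0F , 1F) → first (0F , 1F) (columns 1F)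
    ; (0F , 2F) → first (0F , 2F) antidiagonal
    ; (1F , 0F) → first (1F , 0F) (rows 1F)
    ; (1F , 1F) → refl
    ; (1F , 2F) → last (1F , 2F) (rows 1F)
    ; (2F , 0F) → last (2F , 0F) antidiagonal
    ; (2F , 1F) → last (2F , 1F) (columns 1F)
    ; (2F , 2F) → last (2F , 2F) diagonal
    }
    where
    middleFirst : ∀ x y z → y + (x + z) ≡ x + (y + (z + 0))
    middleFirst = solve-∀

    first : ∀ c → M c + (e + (M (antipode c) + 0)) ≡ magicSum → M c + M (antipode c) ≡ e + e
    first c eq = +-cancelˡ-≡ e _ _
      (trans (middleFirst (M c) e (M (antipode c))) (trans eq magicSum≡3e))

    last : ∀ c → M (antipode c) + (e + (M c + 0)) ≡ magicSum → M c + M (antipode c) ≡ e + e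
    last c eq = trans (+-comm (M c) (M (antipode c))) (+-cancelˡ-≡ e _ _
      (trans (middleFirst (M (antipode c)) e (M c)) (trans eq magicSum≡3e)))

  -- By `antipodal-sum`, passing to the antipode reflects the values in `e` and so reverses the
  -- order.
  antipode-< : ∀ {c d} → M c < M d → M (antipode d) < M (antipode c)
  antipode-< {c} {d} = <-exchange (trans (+-comm (M (antipode c)) (M c))
    (trans (antipodal-sum c) (trans (sym (antipodal-sum d)) (+-comm (M d) (M (antipode d))))))

  -- `e` is the mean of the entries at `c` and its antipode, so it lies below the larger one.
  antipode<⇒centre< : ∀ {c} → M (antipode c) < M c → e < M c
  antipode<⇒centre< {c} c′<c = ≰⇒> λ c≤e →
    <-irrefl (antipodal-sum c) (+-mono-≤-< c≤e (<-≤-trans c′<c c≤e))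

  -- As offsets from the centre: (a − b) + b = a.
  edge-difference : M (1F , 2F) + M (0F , 2F) ≡ e + M (0F , 0F)
  edge-difference = +-cancelʳ-≡ (M (2F , 2F)) _ _
    (begin
      M (1F , 2F) + M (0F , 2F) + M (2F , 2F) ≡⟨ lastApart (M (0F , 2F)) (M (1F , 2F)) (M (2F , 2F)) ⟩
      sum (λ i → M (i , 2F))                  ≡⟨ trans (columns 2F) (sym diagonal) ⟩
      sum (λ i → M (i , i))                   ≡⟨ lastApart (M (0F , 0F)) e (M (2F , 2F)) ⟨
      e + M (0F , 0F) + M (2F , 2F)           ∎)
    where
    open ≡-Reasoning
    lastApart : ∀ x y z → y + x + z ≡ x + (y + (z + 0))
    lastApart = solve-∀

  -- The middle column and the top row share the cell `(0F , 1F)`, which is cancelled. As offsets: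
  -- (a + b) + 0 = a + b.
  edge-sum : M (2F , 1F) + e ≡ M (0F , 0F) + M (0F , 2F)
  edge-sum = +-cancelʳ-≡ (M (0F , 1F)) _ _
    (begin
      M (2F , 1F) + e + M (0F , 1F)           ≡⟨ firstApart (M (0F , 1F)) e (M (2F , 1F)) ⟩
      sum (λ i → M (i , 1F))                  ≡⟨ trans (columns 1F) (sym (rows 0F)) ⟩
      sum (λ j → M (0F , j))                  ≡⟨ middleApart (M (0F , 0F)) (M (0F , 1F)) (M (0F , 2F)) ⟨
      M (0F , 0F) + M (0F , 2F) + M (0F , 1F) ∎)
    where
    open ≡-Reasoning
    firstApart : ∀ x y z → z + y + x ≡ x + (y + (z + 0))
    firstApart = solve-∀
    middleApart : ∀ x y z → x + z + y ≡ x + (y + (z + 0))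
    middleApart = solve-∀

  <⊎> : ∀ {c d} → c ≢ d → M c < M d ⊎ M d < M c
  <⊎> {c} {d} c≢d with <-cmp (M c) (M d)
  ... | tri< c<d _ _ = inj₁ c<d
  ... | tri≈ _ c≡d _ = contradiction (distinct c≡d) c≢d
  ... | tri> _ _ d<c = inj₂ d<c

-- In the notation of the header: 0 < b < a.
Normalised : Matrix → Set
Normalised M = M (2F , 0F) < M (0F , 2F) × M (0F , 2F) < M (0F , 0F)

-- A quarter turn of the square is a quarter turn of the point (a , b), which can
-- therefore be brought to the positive quadrant.
quadrant : ∀ {M} → IsMagicSquare M → ∃ λ k → let N = M ∘ act (rotation k) in
           N (2F , 2F) < N (0F , 0F) × N (2F , 0F) < N (0F , 2F)
quadrant isMagic with <⊎> isMagic {2F , 2F} {0F , 0F} (λ ()) | <⊎> isMagic {2F , 0F} {0F , 2F} (λ ())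
-- One turn replaces (a , b) by (b , -a), so the signs of a and b determine how many turns are
-- required.
... | inj₁ 0<a | inj₁ 0<b = 0F , 0<a , 0<b
... | inj₂ a<0 | inj₁ 0<b = 1F , 0<b , a<0
... | inj₂ a<0 | inj₂ b<0 = 2F , a<0 , b<0
... | inj₁ 0<a | inj₂ b<0 = 3F , b<0 , 0<a

-- Once a and b are positive, `reflect` exchanges the two upper corners, hence a and b, if a < b.
normalise : ∀ {M} → IsMagicSquare M → ∃ λ g → Normalised (M ∘ act g)
normalise isMagic with quadrant isMagic
... | k , 0<a , 0<b with <⊎> (isMagicSquare-act (rotation k) isMagic) {0F , 2F} {0F , 0F} (λ ())
...   | inj₁ b<a = rotation k , 0<b , b<a
...   | inj₂ a<b = reflection k , 0<a , a<b

-- The order types of normalised squares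

-- The cells above the centre in increasing order, with offsets b, a - b, a, a + b and a - b, b, a,
-- a + b respectively.
upperHalf : Fin 2 → Vec Cell 4
upperHalf 0F = (0F , 2F) ∷ (1F , 2F) ∷ (0F , 0F) ∷ (2F , 1F) ∷ []
upperHalf 1F = (1F , 2F) ∷ (0F , 2F) ∷ (0F , 0F) ∷ (2F , 1F) ∷ []

symmetricChain : Vec Cell 4 → List Cell
symmetricChain (p ∷ q ∷ r ∷ s ∷ []) =
  antipode s ∷ antipode r ∷ antipode q ∷ antipode p ∷ centre ∷ p ∷ q ∷ r ∷ s ∷ []

symmetricChain-complete : ∀ t c → c ∈ symmetricChain (upperHalf t)
symmetricChain-complete t (i , j) = decided t i j
  where
  open DecMembership _≟ᶜ_ using (_∈?_)
  decided : ∀ t i j → (i , j) ∈ symmetricChain (upperHalf t)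
  decided = toWitness {a? = all? λ t → all? λ i → all? λ j →
    (i , j) ∈? symmetricChain (upperHalf t)} _

-- The lower half is the antipodal image of the upper one, and the centre is its own antipode.
symmetricChain-increasing : ∀ {M} → IsMagicSquare M → ∀ {p q r s} →
  M centre < M p → M p < M q → M q < M r → M r < M s →
  Increasing M (symmetricChain (p ∷ q ∷ r ∷ s ∷ []))
symmetricChain-increasing isMagic e<p p<q q<r r<s =
  opp r<s ∷ opp q<r ∷ opp p<q ∷ opp e<p ∷ e<p ∷ p<q ∷ q<r ∷ r<s ∷ [-]
  where opp = antipode-< isMagic

OfType : Fin 2 → Matrix → Set
OfType 0F M = M (0F , 2F) < M (1F , 2F)
OfType 1F M = M (1F , 2F) < M (0F , 2F)

-- 0 < b < a yields 0 < a - b < a < a + b; only the comparison of b with a - b is left open, and the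
-- type supplies it.
normalised⇒increasing : ∀ {M} → IsMagicSquare M → Normalised M → ∀ t → OfType t M →
                        Increasing M (symmetricChain (upperHalf t))
normalised⇒increasing {M} isMagic (-b<b , b<a) = λ
  { 0F b<a-b → symmetricChain-increasing isMagic 0<b b<a-b a-b<a a<a+b
  ; 1F a-b<b → symmetricChain-increasing isMagic 0<a-b a-b<b b<a a<a+b
  }
  where
  0<b : M centre < M (0F , 2F)
  0<b = antipode<⇒centre< isMagic -b<b
  0<a-b : M centre < M (1F , 2F)
  0<a-b = <-exchange (edge-difference isMagic) b<a
  a-b<a : M (1F , 2F) < M (0F , 0F)
  a-b<a = <-exchange (trans (+-comm (M (0F , 0F)) (M centre)) (sym (edge-difference isMagic))) 0<b
  a<a+b : M (0F , 0F) < M (2F , 1F)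
  a<a+b = <-exchange (edge-sum isMagic) 0<b

-- (a , b) = (3 , 1) and (a , b) = (3 , 2)
entries : Fin 2 → Vec (Vec ℕ 3) 3
entries 0F = (8 ∷ 1 ∷ 6 ∷ [])
           ∷ (3 ∷ 5 ∷ 7 ∷ [])
           ∷ (4 ∷ 9 ∷ 2 ∷ []) ∷ []
entries 1F = (9 ∷ 1 ∷ 8 ∷ [])
           ∷ (5 ∷ 6 ∷ 7 ∷ [])
           ∷ (4 ∷ 11 ∷ 3 ∷ []) ∷ []

model : Fin 2 → Matrix
model t (i , j) = lookup (lookup (entries t) i) j

model-isMagicSquare : ∀ t → IsMagicSquare (model t)
model-isMagicSquare t = record
  { positive     = λ (i , j) → positive t i j
  ; distinct     = λ { {i , j} {k , l} → distinct t i j k l }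
  ; magicSum     = magicSum t
  ; rows         = toWitness {a? = all? λ t → all? λ i → sum (λ j → model t (i , j)) ≟ magicSum t} _ t
  ; columns      = toWitness {a? = all? λ t → all? λ j → sum (λ i → model t (i , j)) ≟ magicSum t} _ t
  ; diagonal     = toWitness {a? = all? λ t → sum (λ i → model t (i , i)) ≟ magicSum t} _ t
  ; antidiagonal = toWitness {a? = all? λ t → sum (λ i → model t (i , opposite i)) ≟ magicSum t} _ t
  }
  where
  magicSum : Fin 2 → ℕ
  magicSum 0F = 15
  magicSum 1F = 18

  positive : ∀ t i j → 0 < model t (i , j)
  positive = toWitness {a? = all? λ t → all? λ i → all? λ j → 0 <? model t (i , j)} _

  distinct : ∀ t i j k l → model t (i , j) ≡ model t (k , l) → (i , j) ≡ (k , l)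
  distinct = toWitness {a? = all? λ t → all? λ i → all? λ j → all? λ k → all? λ l →
    (model t (i , j) ≟ model t (k , l)) →-dec ((i , j) ≟ᶜ (k , l))} _

model-increasing : ∀ t → Increasing (model t) (symmetricChain (upperHalf t))
model-increasing t = normalised⇒increasing (model-isMagicSquare t) (normalised t) t (ofType t)
  where
  normalised : ∀ t → Normalised (model t)
  normalised = toWitness {a? = all? λ t →
    (model t (2F , 0F) <? model t (0F , 2F)) ×-dec (model t (0F , 2F) <? model t (0F , 0F))} _

  ofType : ∀ t → OfType t (model t)
  -- The entries compared are those at `(0F , 2F)` and `(1F , 2F)`.
  ofType 0F = toWitness {a? = 6 <? 7} _
  ofType 1F = toWitness {a? = 7 <? 8} _

normalised⇒model : ∀ {M} → IsMagicSquare M → Normalised M →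
                   ∃ λ t → ∀ a b → M a < M b ⇔ model t a < model t b
normalised⇒model {M} isMagic normalised = ofType⇒model (type (<⊎> isMagic (λ ())))
  where
  type : M (0F , 2F) < M (1F , 2F) ⊎ M (1F , 2F) < M (0F , 2F) → ∃ λ t → OfType t M
  type (inj₁ b<a-b) = 0F , b<a-b
  type (inj₂ a-b<b) = 1F , a-b<b

  ofType⇒model : (∃ λ t → OfType t M) → ∃ λ t → ∀ a b → M a < M b ⇔ model t a < model t b
  ofType⇒model (t , ofType) = t , increasing⇒sameOrder (symmetricChain-complete t)
    (normalised⇒increasing isMagic normalised t ofType) (model-increasing t)

-- The normalising symmetry is undone by evaluating the comparison for `M ∘ act g` at cells moved by
-- the inverse of `g`.
magicSquare⇒model : ∀ {M} → IsMagicSquare M →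
  ∃₂ λ t g → ∀ a b → M a < M b ⇔ model t (act g a) < model t (act g b)
magicSquare⇒model {M} isMagic =
  let g , normalised = normalise isMagic
      t , order      = normalised⇒model (isMagicSquare-act g isMagic) normalised
      h , gh≡1       = act-⁻¹ g
  in t , h , λ a b → subst₂ (λ x y → M x < M y ⇔ model t (act h a) < model t (act h b))
                       (gh≡1 a) (gh≡1 b) (order (act h a) (act h b))

-- Counting

-- Codes the symmetries by finite indices, so that `all?` can run through them.
symmetry : Fin 2 → Fin 4 → Symmetry
symmetry 0F = rotation
symmetry 1F = reflection

variant : Fin 2 → Symmetry → MagicSquare
variant t g = model t ∘ act g , isMagicSquare-act g (model-isMagicSquare t)

realised : MagicSquare → OrderType
realised S = orderType S , S , Setoid.refl linearOrderings {orderType S}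

-- The coordinates are quantified separately so that any? decides this.
Distinguished : Matrix → Matrix → Set
Distinguished M N = ∃₂ λ i j → ∃₂ λ k l → M (i , j) < M (k , l) × ¬ N (i , j) < N (k , l)

distinguished? : ∀ M N → Dec (Distinguished M N)
distinguished? M N = any? λ i → any? λ j → any? λ k → any? λ l →
  (M (i , j) <? M (k , l)) ×-dec ¬? (N (i , j) <? N (k , l))

sameOrder⇒¬distinguished : ∀ {M N : Matrix} → (∀ a b → M a < M b ⇔ N a < N b) → ¬ Distinguished M N
sameOrder⇒¬distinguished same (i , j , k , l , M< , N≮) =
  N≮ (Equivalence.to (same (i , j) (k , l)) M<)

variant₁₆ : Fin 16 → MagicSquare
variant₁₆ n = let t , p = remQuot {2} 8 n in variant t (uncurry symmetry (remQuot {2} 4 p))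

variant₁₆-surjective : ∀ t g → ∃ λ n → variant t g ≡ variant₁₆ n
variant₁₆-surjective t = λ
  { (rotation k)   → index 0F k
  ; (reflection k) → index 1F k
  }
  where
  index : ∀ m k → ∃ λ n → variant t (symmetry m k) ≡ variant₁₆ n
  index m k = combine t (combine m k) , sym (trans
    (cong (λ (t , p) → variant t (uncurry symmetry (remQuot {2} 4 p))) (remQuot-combine t (combine m k)))
    (cong (λ p → variant t (uncurry symmetry p)) (remQuot-combine m k)))

-- Checked exhaustively. Within one model the variants differ because a symmetry is determined by
-- its effect on the two largest corners, which are adjacent.
variants₁₆-distinguished : ∀ n m → n ≡ m ⊎ Distinguished (proj₁ (variant₁₆ n)) (proj₁ (variant₁₆ m))
variants₁₆-distinguished = toWitness {a? = all? λ n → all? λ m →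
  (n Fin.≟ m) ⊎-dec distinguished? (proj₁ (variant₁₆ n)) (proj₁ (variant₁₆ m))} _

-- Symmetries preserve corners and edges, while the cell next above the centre is a corner in
-- `model 0F` and an edge in `model 1F`. The proof itself is a finite check.
models-distinguished : ∀ t u g → t ≡ u ⊎ Distinguished (model t) (model u ∘ act g)
models-distinguished t u = λ
  { (rotation k)   → decided t u 0F k
  ; (reflection k) → decided t u 1F k
  }
  where
  decided : ∀ t u m k → t ≡ u ⊎ Distinguished (model t) (model u ∘ act (symmetry m k))
  decided = toWitness {a? = all? λ t → all? λ u → all? λ m → all? λ k →
    (t Fin.≟ u) ⊎-dec distinguished? (model t) (model u ∘ act (symmetry m k))} _

orderTypes-cardinality : HasCardinality orderTypes 16
orderTypes-cardinality =
  classification⇒cardinality orderTypes (realised ∘ variant₁₆) separated covering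
  where
  separated : ∀ n m → Setoid._≈_ orderTypes (realised (variant₁₆ n)) (realised (variant₁₆ m)) → n ≡ m
  separated n m same = fromInj₁
    (λ d → contradiction d (sameOrder⇒¬distinguished same)) (variants₁₆-distinguished n m)

  covering : ∀ x → ∃ λ n → Setoid._≈_ orderTypes x (realised (variant₁₆ n))
  covering (L , (M , isMagic) , L≈M) =
    let t , g , M≈model = magicSquare⇒model isMagic
        n , eq          = variant₁₆-surjective t g
    in n , λ a b → subst (λ (N , _) → LinearOrdering._≺_ L a b ⇔ N a < N b) eq
                         (M≈model a b Composition.⇔-∘ L≈M a b)

orderTypesUpToSymmetry-cardinality : HasCardinality orderTypesUpToSymmetry 2
orderTypesUpToSymmetry-cardinality =
  classification⇒cardinality orderTypesUpToSymmetry representative separated covering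
  where
  representative : Fin 2 → OrderType
  representative t = realised (model t , model-isMagicSquare t)

  separated : ∀ t u → Setoid._≈_ orderTypesUpToSymmetry (representative t) (representative u) → t ≡ u
  separated t u (g , same) = fromInj₁
    (λ d → contradiction d (sameOrder⇒¬distinguished same)) (models-distinguished t u g)

  covering : ∀ x → ∃ λ t → Setoid._≈_ orderTypesUpToSymmetry x (representative t)
  covering (L , (M , isMagic) , L≈M) =
    let t , g , M≈model = magicSquare⇒model isMagic
    in t , g , λ a b → M≈model a b Composition.⇔-∘ L≈M a b

mainTheorem7 : HasCardinality orderTypes 16 × HasCardinality orderTypesUpToSymmetry 2
mainTheorem7 = orderTypes-cardinality , orderTypesUpToSymmetry-cardinality
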